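{- For every graph $G$, let $P$ be a path with $|V(G)|$ vertices and let $\Pi$ be the set of all bijections $\pi : V(G) \rightarrow V(P)$. Then $$\min_{\pi \in \Pi}\ \max_{u \in V(P)} |\{vw \in E(G) : u \in V(P_{vw})\}| = \mathrm{pw}(L(G)) + 1,$$ where, for a given $\pi$, $P_{vw}$ denotes the subpath of $P$ from $\pi(v)$ to $\pi(w)$.
   Context: Graphs are finite, simple and undirected, and $G$ has at least one vertex. The line graph $L(G)$ has vertex set $E(G)$, two distinct elements being adjacent if and only if the corresponding edges of $G$ share an endpoint. A path decomposition of a graph $H$ is a (nonempty) path $Q$ together with a collection of subsets of $V(H)$ (bags) indexed by the nodes of $Q$ such that: every vertex of $H$ is in at least one bag; for each vertex $v$ of $H$, the nodes whose bags contain $v$ induce a connected subpath of $Q$; and for each edge of $H$ some bag contains both its endpoints. Its width is the size of the largest bag minus 1, and the pathwidth $\mathrm{pw}(H)$ is the minimum width of a path decomposition of $H$ (so $\mathrm{pw}(H)=-1$ if $H$ has no vertices). -}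

module Defs where

open import Level using (0ℓ)
open import Data.Nat using (ℕ; suc)
open import Data.Integer as ℤ using (ℤ; +_; 1ℤ)
open import Data.Fin using (Fin; zero; suc; _≤_)
open import Data.Fin.Properties using (_≟_; _≤?_; _<?_; any?)
open import Data.Fin.Subset using (Subset; _∈_; ∣_∣)
open import Data.List using (List; length; lookup; filter; cartesianProduct; allFin; tabulate)
open import Data.List.Extrema.Nat using (max)
import Data.Vec as Vec
open import Data.Product using (_×_; _,_; proj₁; proj₂; ∃; ∃-syntax)
open import Data.Sum using (_⊎_)
open import Function using (_∘_)
open import Function.Bundles using (_⤖_; module Bijection)
open import Relation.Binary using (Rel; Decidable; Symmetric)
open import Relation.Binary.PropositionalEquality using (_≡_; _≢_; refl; sym)
open import Relation.Nullary using (¬_; Dec; does)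
open import Relation.Nullary.Decidable using (_×-dec_; _⊎-dec_; ¬?)

-- Finite simple undirected graphs, with vertices labelled by Fin n.
record Graph (n : ℕ) : Set₁ where
  field
    Adj        : Rel (Fin n) 0ℓ
    adj?       : Decidable Adj
    adj-sym    : Symmetric Adj
    adj-irrefl : ∀ v → ¬ Adj v v

-- Every edge occurs exactly once, as the pair of its endpoints in
-- increasing order.
edges : ∀ {n} → Graph n → List (Fin n × Fin n)
edges {n} G =
  filter (λ (v , w) → (v <? w) ×-dec Graph.adj? G v w)
         (cartesianProduct (allFin n) (allFin n))

size : ∀ {n} → Graph n → ℕ
size G = length (edges G)

module _ {n} (G : Graph n) where

  Edge : Set
  Edge = Fin (size G)

  end₁ end₂ : Edge → Fin n
  end₁ e = proj₁ (lookup (edges G) e)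
  end₂ e = proj₂ (lookup (edges G) e)

  IsEndpoint : Fin n → Edge → Set
  IsEndpoint v e = v ≡ end₁ e ⊎ v ≡ end₂ e

  isEndpoint? : ∀ v e → Dec (IsEndpoint v e)
  isEndpoint? v e = (v ≟ end₁ e) ⊎-dec (v ≟ end₂ e)

  lineGraph : Graph (size G)
  lineGraph = record
    { Adj        = λ e f → e ≢ f × ∃[ v ] (IsEndpoint v e × IsEndpoint v f)
    ; adj?       = λ e f → ¬? (e ≟ f)
                     ×-dec any? (λ v → isEndpoint? v e ×-dec isEndpoint? v f)
    ; adj-sym    = λ (e≢f , v , ve , vf) → e≢f ∘ sym , v , vf , ve
    ; adj-irrefl = λ _ (e≢e , _) → e≢e refl
    }

-- The path with k vertices is Fin k, consecutive elements being adjacent;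
-- OnSubpath x y u says that u lies on its subpath from x to y, where x and y
-- may come in either order.
OnSubpath : ∀ {k} → Fin k → Fin k → Fin k → Set
OnSubpath x y u = (x ≤ u × u ≤ y) ⊎ (y ≤ u × u ≤ x)

onSubpath? : ∀ {k} (x y u : Fin k) → Dec (OnSubpath x y u)
onSubpath? x y u = ((x ≤? u) ×-dec (u ≤? y)) ⊎-dec ((y ≤? u) ×-dec (u ≤? x))

maximum : ∀ {k} → (Fin (suc k) → ℕ) → ℕ
maximum f = max (f zero) (tabulate (f ∘ suc))

IsMinimum : {A B : Set} → Rel B 0ℓ → (A → B) → B → Set
IsMinimum _≲_ f m = (∃[ a ] f a ≡ m) × (∀ a → m ≲ f a)

-- The underlying path is nonempty: it has suc len nodes.
record PathDecomposition {n} (H : Graph n) : Set where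
  field
    len       : ℕ
    bag       : Fin (suc len) → Subset n
    covers    : ∀ v → ∃[ x ] v ∈ bag x
    connected : ∀ v {x y z} → v ∈ bag x → v ∈ bag y →
                OnSubpath x y z → v ∈ bag z
    edge      : ∀ {v w} → Graph.Adj H v w → ∃[ x ] (v ∈ bag x × w ∈ bag x)

  width : ℤ
  width = + maximum (λ x → ∣ bag x ∣) ℤ.- 1ℤ

IsPathwidth : ∀ {n} → Graph n → ℤ → Set
IsPathwidth H = IsMinimum ℤ._≤_ (PathDecomposition.width {H = H})

module _ {n} (G : Graph n) (π : Fin n ⤖ Fin n) where
  open Bijection π using (to)

  edgesThrough : Fin n → Subset (size G)
  edgesThrough u =
    Vec.tabulate λ e → does (onSubpath? (to (end₁ G e)) (to (end₂ G e)) u)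

{-# OPTIONS --safe #-}
-- A layout π yields a path decomposition of the line graph whose bag at u is
-- the set of edges passing over u: the edges at a vertex v meet at π(v).
-- Conversely, the edges at v form a clique of the line graph, so by the Helly
-- property of intervals some node x(v) has a bag containing all of them.  List
-- the vertices by increasing x(v).  If the edge vw passes over the position of
-- a, then x(a) lies between x(v) and x(w), whose bags both contain vw, so vw is
-- in the bag at x(a).  Hence no position is passed over by more edges than the
-- largest bag contains.
module Submission where

open import Data.Nat as ℕ using (ℕ; suc; _≤_; _∸_)
import Data.Nat.Properties as ℕ
open import Data.Integer as ℤ using (ℤ; +_; 1ℤ; -1ℤ)
import Data.Integer.Properties as ℤ
open import Data.Fin as Fin using (Fin; zero; suc; toℕ; fromℕ<; combine; finToFun; funToFin; punchOut)
import Data.Fin.Properties as Fin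
open import Data.Fin.Subset using (Subset; ∣_∣; _∈_; _∉_; _⊆_; _⊂_)
open import Data.Fin.Subset.Properties using (_∈?_; ∈⊤; ⊆⊤; ∣⊤∣≡n; p⊆q⇒∣p∣≤∣q∣; p⊂q⇒∣p∣<∣q∣)
open import Data.List using (filter; allFin; tabulate)
open import Data.List.Extrema.Nat using (argmin; argmin-all; f[argmin]≤f[xs]; max≤v⁺; ⊥≤max; xs≤max)
open import Data.List.Membership.Propositional.Properties using (∈-allFin; ∈-filter⁺)
import Data.List.Relation.Unary.All as All
open import Data.List.Relation.Unary.All.Properties using (all-filter; tabulate⁺; tabulate⁻)
import Data.Vec as Vec
open import Data.Vec.Properties using (lookup∘tabulate; tabulate-cong; []=⇒lookup; lookup⇒[]=)
open import Data.Product using (_×_; _,_; proj₁; proj₂; ∃; ∃-syntax; Σ-syntax)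
open import Data.Sum using (inj₁; inj₂)
open import Function using (_∘_)
open import Function.Bundles using (_⤖_; mk⤖; module Bijection)
open import Function.Consequences.Propositional using (strictlySurjective⇒surjective)
open import Function.Definitions using (Injective; StrictlySurjective)
open import Relation.Binary using (tri<; tri≈; tri>)
open import Relation.Binary.PropositionalEquality
  using (_≡_; _≢_; _≗_; refl; sym; trans; cong; cong₂; subst; subst₂; module ≡-Reasoning)
open import Relation.Nullary using (Dec; yes; no; does; contradiction)
open import Relation.Nullary.Decidable using (dec-true; map′; _→-dec_)
open import Relation.Unary using (Pred; Decidable)
open import Level using (0ℓ)
open import Defs

-- Comprehensions and minima over finite sets

module _ {n} {P : Pred (Fin n) 0ℓ} (P? : Decidable P) where

  ∈-comprehension⁺ : ∀ {x} → P x → x ∈ Vec.tabulate (does ∘ P?)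
  ∈-comprehension⁺ {x} px =
    lookup⇒[]= x _ (trans (lookup∘tabulate _ x) (dec-true (P? x) px))

  ∈-comprehension⁻ : ∀ {x} → x ∈ Vec.tabulate (does ∘ P?) → P x
  ∈-comprehension⁻ {x} x∈ with P? x | trans (sym (lookup∘tabulate (does ∘ P?) x)) ([]=⇒lookup x∈)
  ... | yes px | _ = px

  minimiser : (f : Fin n → ℕ) → ∃ P → ∃[ a ] (P a × ∀ {b} → P b → f a ≤ f b)
  minimiser f (x , px) =
    -- `x` is the default value of `argmin`; it satisfies `P` itself, so the result does in every
    -- case.
    argmin f x candidates ,
    argmin-all f px (all-filter P? (allFin n)) ,
    λ {b} pb → All.lookup (f[argmin]≤f[xs] x candidates) (∈-filter⁺ P? (∈-allFin b) pb)
    where candidates = filter P? (allFin n)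

≤maximum : ∀ {k} (f : Fin (suc k) → ℕ) u → f u ≤ maximum f
≤maximum f zero    = ⊥≤max (f zero) (tabulate (f ∘ suc))
≤maximum f (suc u) = tabulate⁻ (xs≤max (f zero) _) u

maximum≤ : ∀ {k} {f : Fin (suc k) → ℕ} {b} → (∀ u → f u ≤ b) → maximum f ≤ b
maximum≤ f≤b = max≤v⁺ (f≤b zero) (tabulate⁺ (f≤b ∘ suc))

maximum-mono : ∀ {k} {f g : Fin (suc k) → ℕ} → (∀ u → f u ≤ g u) → maximum f ≤ maximum g
maximum-mono {g = g} f≤g = maximum≤ λ u → ℕ.≤-trans (f≤g u) (≤maximum g u)

-- Injective self-maps of a finite set

injective? : ∀ {m n} (f : Fin m → Fin n) → Dec (Injective _≡_ _≡_ f)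
injective? f = map′ (λ inj {i} {j} → inj i j) (λ inj i j → inj)
  (Fin.all? λ i → Fin.all? λ j → (f i Fin.≟ f j) →-dec (i Fin.≟ j))

-- Pigeonhole: a missed value `y` could be punched out of the codomain, leaving an injection from
-- `Fin (suc n)` into `Fin n`.
injective⇒strictlySurjective : ∀ {n} {f : Fin n → Fin n} →
  Injective _≡_ _≡_ f → StrictlySurjective _≡_ f
injective⇒strictlySurjective {suc n} {f} inj y with Fin.any? (λ x → f x Fin.≟ y)
... | yes hit = hit
... | no miss = contradiction (Fin.injective⇒≤ avoid-injective) ℕ.1+n≰n
  where
  y≢f : ∀ x → y ≢ f x
  y≢f x y≡fx = miss (x , sym y≡fx)

  avoid : Fin (suc n) → Fin n
  avoid x = punchOut (y≢f x)

  avoid-injective : Injective _≡_ _≡_ avoid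
  avoid-injective = inj ∘ Fin.punchOut-injective (y≢f _) (y≢f _)

injective⇒⤖ : ∀ {n} {f : Fin n → Fin n} → Injective _≡_ _≡_ f → Fin n ⤖ Fin n
injective⇒⤖ inj =
  mk⤖ (inj , strictlySurjective⇒surjective (injective⇒strictlySurjective inj))

-- Sorting by rank

module _ {n N} (key : Fin n → Fin N) where

  predecessors : Fin n → Subset n
  predecessors v = Vec.tabulate λ w → does (key w Fin.<? key v)

  v∉predecessors : ∀ {v} → v ∉ predecessors v
  v∉predecessors {v} =
    ℕ.<-irrefl refl ∘ ∈-comprehension⁻ (λ w → key w Fin.<? key v)

  -- Strictness is witnessed by `v`, which precedes `w` but not itself. Passing to cardinalities
  -- then makes ranks strictly increasing.
  predecessors-⊂ : ∀ {v w} → key v Fin.< key w → predecessors v ⊂ predecessors w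
  predecessors-⊂ {v} {w} v<w =
    (λ u∈ → ∈-comprehension⁺ (λ u → key u Fin.<? key w)
              (ℕ.<-trans (∈-comprehension⁻ (λ u → key u Fin.<? key v) u∈) v<w)) ,
    v , ∈-comprehension⁺ (λ u → key u Fin.<? key w) v<w , v∉predecessors

  ∣predecessors∣<n : ∀ v → ∣ predecessors v ∣ ℕ.< n
  ∣predecessors∣<n v = subst (∣ predecessors v ∣ ℕ.<_) (∣⊤∣≡n n)
    (p⊂q⇒∣p∣<∣q∣ (⊆⊤ , v , ∈⊤ , v∉predecessors))

  rank : Fin n → Fin n
  rank v = fromℕ< (∣predecessors∣<n v)

  rank-mono-< : ∀ {v w} → key v Fin.< key w → rank v Fin.< rank w
  rank-mono-< v<w = subst₂ ℕ._<_
    (sym (Fin.toℕ-fromℕ< _)) (sym (Fin.toℕ-fromℕ< _)) (p⊂q⇒∣p∣<∣q∣ (predecessors-⊂ v<w))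

  rank-injective : Injective _≡_ _≡_ key → Injective _≡_ _≡_ rank
  rank-injective inj {v} {w} eq with Fin.<-cmp (key v) (key w)
  ... | tri< v<w _ _ = contradiction eq (Fin.<⇒≢ (rank-mono-< v<w))
  ... | tri≈ _ v≡w _ = inj v≡w
  ... | tri> _ _ w<v = contradiction (sym eq) (Fin.<⇒≢ (rank-mono-< w<v))

-- Proved by contraposition: `x w < x v` makes the key, and hence the rank, of `w` strictly smaller.
sortBy : ∀ {n k} (x : Fin n → Fin k) →
  Σ[ π ∈ Fin n ⤖ Fin n ] ∀ {v w} → Bijection.to π v Fin.≤ Bijection.to π w → x v Fin.≤ x w
sortBy {n} {k} x =
  injective⇒⤖ (rank-injective key key-injective) ,
  λ πv≤πw → ℕ.≮⇒≥ λ xw<xv → ℕ.<⇒≱ (rank-mono-< key (Fin.combine-monoˡ-< _ _ xw<xv)) πv≤πw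
  where
  -- `combine` orders pairs lexicographically, so the second component only breaks ties of `x` and
  -- makes the key injective.
  key : Fin n → Fin (k ℕ.* n)
  key v = combine (x v) v

  key-injective : Injective _≡_ _≡_ key
  key-injective {v} {w} = Fin.combine-injectiveʳ (x v) v (x w) w

-- Helly property for cliques

module _ {n} {H : Graph n} (D : PathDecomposition H) where
  open PathDecomposition D

  -- The left end of the interval of nodes whose bags contain `v`.
  firstNode : ∀ v → ∃[ x ] (v ∈ bag x × ∀ {y} → v ∈ bag y → x Fin.≤ y)
  firstNode v = minimiser (λ x → v ∈? bag x) toℕ (covers v)

  first : Fin n → Fin (suc len)
  first = proj₁ ∘ firstNode

  clique⊆bag : ∀ {C : Pred (Fin n) 0ℓ} → Decidable C →
    (∀ {v w} → C v → C w → ∃[ x ] (v ∈ bag x × w ∈ bag x)) →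
    ∃[ x ] (∀ {v} → C v → v ∈ bag x)
  clique⊆bag C? meet with Fin.any? C?
  -- This case arises for the star of an isolated vertex; any node serves.
  ... | no empty = zero , λ cv → contradiction (_ , cv) empty
  -- The vertex of the clique that appears last is met by all the others where it first appears.
  ... | yes nonempty =
    -- Subtracting from `len` reverses the order, so that `minimiser` finds the largest `first v`.
    let e , ce , latest = minimiser C? (λ v → len ∸ toℕ (first v)) nonempty
    in first e , λ {f} cf →
      let y , e∈y , f∈y = meet ce cf
          _ , f∈first , _ = firstNode f
          _ , _ , e-first = firstNode e
      -- Here `first f ≤ first e ≤ y`, and `f` is in the bags at both extremes. The first inequality
      -- cancels the truncated subtraction, which is legitimate because `first f ≤ len`.
      in connected f f∈first f∈y
           (inj₁ (ℕ.∸-cancelʳ-≤ (Fin.toℕ≤pred[n] (first f)) (latest cf) , e-first e∈y))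

-- Betweenness on a path

OnSubpath-image : ∀ {k m n} {π : Fin n → Fin k} {x : Fin n → Fin m} →
  (∀ {v w} → π v Fin.≤ π w → x v Fin.≤ x w) →
  ∀ {v w u} → OnSubpath (π v) (π w) (π u) → OnSubpath (x v) (x w) (x u)
OnSubpath-image mono (inj₁ (v≤u , u≤w)) = inj₁ (mono v≤u , mono u≤w)
OnSubpath-image mono (inj₂ (w≤u , u≤v)) = inj₂ (mono w≤u , mono u≤v)

OnSubpath-start : ∀ {k} (x y : Fin k) → OnSubpath x y x
OnSubpath-start x y with ℕ.≤-total (toℕ x) (toℕ y)
... | inj₁ x≤y = inj₁ (ℕ.≤-refl , x≤y)
... | inj₂ y≤x = inj₂ (y≤x , ℕ.≤-refl)

OnSubpath-sym : ∀ {k} {x y u : Fin k} → OnSubpath x y u → OnSubpath y x u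
OnSubpath-sym (inj₁ p) = inj₂ p
OnSubpath-sym (inj₂ p) = inj₁ p

-- When `a ≤ b`, the reversed alternative forces `a`, `b` and `x` to coincide.
OnSubpath-ordered : ∀ {k} {a b x : Fin k} → a Fin.≤ b → OnSubpath a b x → a Fin.≤ x × x Fin.≤ b
OnSubpath-ordered a≤b (inj₁ a≤x≤b)       = a≤x≤b
OnSubpath-ordered a≤b (inj₂ (b≤x , x≤a)) = ℕ.≤-trans a≤b b≤x , ℕ.≤-trans x≤a a≤b

interval-convex : ∀ {k} {a b x y z : Fin k} →
  a Fin.≤ x × x Fin.≤ b → a Fin.≤ y × y Fin.≤ b → OnSubpath x y z → a Fin.≤ z × z Fin.≤ b
interval-convex (a≤x , _) (_ , y≤b) (inj₁ (x≤z , z≤y)) = ℕ.≤-trans a≤x x≤z , ℕ.≤-trans z≤y y≤b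
interval-convex (_ , x≤b) (a≤y , _) (inj₂ (y≤z , z≤x)) = ℕ.≤-trans a≤y y≤z , ℕ.≤-trans z≤x x≤b

-- This gives the connectedness of the bags of a layout. Swapping `a` and `b` reduces it to ordered
-- endpoints.
OnSubpath-convex : ∀ {k} {a b x y z : Fin k} →
  OnSubpath a b x → OnSubpath a b y → OnSubpath x y z → OnSubpath a b z
OnSubpath-convex {a = a} {b} p q r with ℕ.≤-total (toℕ a) (toℕ b)
... | inj₁ a≤b = inj₁ (interval-convex (OnSubpath-ordered a≤b p) (OnSubpath-ordered a≤b q) r)
... | inj₂ b≤a = inj₂ (interval-convex
  (OnSubpath-ordered b≤a (OnSubpath-sym p)) (OnSubpath-ordered b≤a (OnSubpath-sym q)) r)

-- Layouts and decompositions of the line graph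

module _ {n} (G : Graph (suc n)) where

  -- Taking arbitrary maps rather than bijections allows evaluation at decoded functions. At a
  -- bijection it unfolds to the maximum over `edgesThrough`.
  congestion : (Fin (suc n) → Fin (suc n)) → ℕ
  congestion π = maximum λ u →
    ∣ Vec.tabulate (λ e → does (onSubpath? (π (end₁ G e)) (π (end₂ G e)) u)) ∣

  congestion-cong : ∀ {π ρ} → π ≗ ρ → congestion π ≤ congestion ρ
  congestion-cong π≗ρ = maximum-mono λ u → ℕ.≤-reflexive (cong ∣_∣ (tabulate-cong λ e →
    cong₂ (λ x y → does (onSubpath? x y u)) (π≗ρ (end₁ G e)) (π≗ρ (end₂ G e))))

  -- Self-maps are enumerated by the codes in `Fin (suc n ^ suc n)`, and a minimum is taken over the
  -- injective ones. Decoding recovers a layout only pointwise, whence `congestion-cong`.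
  optimalLayout : Σ[ π ∈ Fin (suc n) ⤖ Fin (suc n) ] ∀ (ρ : Fin (suc n) ⤖ Fin (suc n)) →
    congestion (Bijection.to π) ≤ congestion (Bijection.to ρ)
  optimalLayout =
    let c , inj , least = minimiser (λ c → injective? (decode c)) (congestion ∘ decode)
                            -- The identity shows that some code is injective.
                            (encode (λ x → x) , decode-injective (λ eq → eq))
    in injective⇒⤖ inj , λ ρ → ℕ.≤-trans
         (least (decode-injective (Bijection.injective ρ)))
         (congestion-cong (Fin.finToFun-funToFin (Bijection.to ρ)))
    where
    encode : (Fin (suc n) → Fin (suc n)) → Fin (suc n ℕ.^ suc n)
    encode = funToFin

    decode : Fin (suc n ℕ.^ suc n) → Fin (suc n) → Fin (suc n)
    decode = finToFun

    decode-injective : ∀ {f} → Injective _≡_ _≡_ f → Injective _≡_ _≡_ (decode (encode f))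
    decode-injective {f} inj {x} {y} eq = inj (begin
      f x                   ≡⟨ Fin.finToFun-funToFin f x ⟨
      decode (encode f) x   ≡⟨ eq ⟩
      decode (encode f) y   ≡⟨ Fin.finToFun-funToFin f y ⟩
      f y                   ∎)
      where open ≡-Reasoning

  layout⇒decomposition : (Fin (suc n) ⤖ Fin (suc n)) → PathDecomposition (lineGraph G)
  layout⇒decomposition π = record
    { len       = n
    ; bag       = edgesThrough G π
    ; covers    = λ e → to (end₁ G e) , at-endpoint (inj₁ refl)
    ; connected = λ e e∈x e∈y z-between → ∈-comprehension⁺ (through? _)
                    (OnSubpath-convex (∈-comprehension⁻ (through? _) e∈x)
                                      (∈-comprehension⁻ (through? _) e∈y) z-between)
    ; edge      = λ (_ , v , v∈e , v∈f) → to v , at-endpoint v∈e , at-endpoint v∈f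
    }
    where
    open Bijection π using (to)

    through? : ∀ u e → Dec (OnSubpath (to (end₁ G e)) (to (end₂ G e)) u)
    through? u e = onSubpath? _ _ u

    at-endpoint : ∀ {v e} → IsEndpoint G v e → e ∈ edgesThrough G π (to v)
    at-endpoint (inj₁ refl) = ∈-comprehension⁺ (through? _) (OnSubpath-start _ _)
    at-endpoint (inj₂ refl) = ∈-comprehension⁺ (through? _) (OnSubpath-sym (OnSubpath-start _ _))

  module _ (D : PathDecomposition (lineGraph G)) where
    open PathDecomposition D

    star⊆bag : ∀ v → ∃[ x ] (∀ {e} → IsEndpoint G v e → e ∈ bag x)
    star⊆bag v = clique⊆bag D (isEndpoint? G v) meet
      where
      meet : ∀ {e f} → IsEndpoint G v e → IsEndpoint G v f → ∃[ x ] (e ∈ bag x × f ∈ bag x)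
      meet {e} {f} v∈e v∈f with e Fin.≟ f
      -- Adjacency in `lineGraph` requires distinct edges, so a repeated edge is handled by
      -- `covers`.
      ... | yes refl = let x , e∈x = covers e in x , e∈x , e∈x
      ... | no  e≢f  = edge (e≢f , v , v∈e , v∈f)

    starNode : Fin (suc n) → Fin (suc len)
    starNode = proj₁ ∘ star⊆bag

    through⊆bag : (π : Fin (suc n) ⤖ Fin (suc n)) (let open Bijection π using (to)) →
      (∀ {v w} → to v Fin.≤ to w → starNode v Fin.≤ starNode w) →
      ∀ a → edgesThrough G π (to a) ⊆ bag (starNode a)
    through⊆bag π mono a {e} e∈ = connected e
      (proj₂ (star⊆bag (end₁ G e)) (inj₁ refl))
      (proj₂ (star⊆bag (end₂ G e)) (inj₂ refl))
      (OnSubpath-image {π = to} {x = starNode} mono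
        (∈-comprehension⁻ (λ e → onSubpath? (to (end₁ G e)) (to (end₂ G e)) (to a)) e∈))
      where open Bijection π using (to)

    sorted-congestion≤ : (π : Fin (suc n) ⤖ Fin (suc n)) (let open Bijection π using (to)) →
      (∀ {v w} → to v Fin.≤ to w → starNode v Fin.≤ starNode w) →
      congestion to ≤ maximum (λ x → ∣ bag x ∣)
    sorted-congestion≤ π mono = maximum≤ λ u →
      -- `through⊆bag` speaks of positions of vertices; by surjectivity these are all positions.
      let a , a↦u = Bijection.strictlySurjective π u
      in subst (λ u → ∣ edgesThrough G π u ∣ ≤ maximum (λ x → ∣ bag x ∣)) a↦u
           (ℕ.≤-trans (p⊆q⇒∣p∣≤∣q∣ (through⊆bag π mono a)) (≤maximum (λ x → ∣ bag x ∣) (starNode a)))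

    decomposition⇒layout : Σ[ π ∈ Fin (suc n) ⤖ Fin (suc n) ]
      congestion (Bijection.to π) ≤ maximum (λ x → ∣ bag x ∣)
    decomposition⇒layout =
      let π , mono = sortBy starNode in π , sorted-congestion≤ π mono

-- The two directions are asymmetric: equality in the first lets the image of an optimal `a` attain
-- the minimum of `g`, while an inequality in the second suffices for the lower bound.
minimum-transfer : {A B : Set} (f : A → ℕ) (g : B → ℕ) →
  ∃[ a ] (∀ a′ → f a ≤ f a′) →
  (∀ a → ∃[ b ] g b ≡ f a) → (∀ b → ∃[ a ] f a ≤ g b) →
  ∃[ m ] ∃[ p ]
    ( IsMinimum _≤_ f m
    × IsMinimum ℤ._≤_ (λ b → + g b ℤ.- 1ℤ) p
    × + m ≡ p ℤ.+ 1ℤ )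
minimum-transfer f g (a , least) A⇒B B⇒A =
  f a , + f a ℤ.- 1ℤ ,
  ((a , refl) , least) ,
  ((proj₁ (A⇒B a) , cong (λ k → + k ℤ.- 1ℤ) (proj₂ (A⇒B a))) ,
   λ b → ℤ.+-monoˡ-≤ -1ℤ (ℤ.+≤+ (ℕ.≤-trans (least (proj₁ (B⇒A b))) (proj₂ (B⇒A b))))) ,
  sym (trans (ℤ.+-assoc (+ f a) -1ℤ 1ℤ) (ℤ.+-identityʳ (+ f a)))

theorem2p6 : ∀ (n : ℕ) (G : Graph (suc n)) →
    ∃[ m ] ∃[ p ]
    ( IsMinimum _≤_ (λ (π : Fin (suc n) ⤖ Fin (suc n)) → maximum (λ u → ∣ edgesThrough G π u ∣)) m
    × IsPathwidth (lineGraph G) p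
    × + m ≡ p ℤ.+ 1ℤ )
theorem2p6 n G = minimum-transfer
  (λ π → congestion G (Bijection.to π))
  (λ D → maximum λ x → ∣ PathDecomposition.bag D x ∣)
  (optimalLayout G)
  -- `refl` suffices because the bags are `edgesThrough G π` by definition.
  (λ π → layout⇒decomposition G π , refl)
  (decomposition⇒layout G)
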